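{- Let $G$ be a triangle-free graph that contains no isolated vertex. Then (i) $\displaystyle a_1(G) = \min_{k \geq 0} \max\{k,\, n(G)-\alpha_k(G)\} = \min_{X\subseteq V(G)} \max\{\Delta(G-X),\, |X|\}$, where $k$ ranges over the non-negative integers; and (ii) $a_1'(G) = \Delta(G)$.
   Context: All graphs are finite, simple, and have at least one vertex. A clique of a graph $G$ is an inclusion-wise maximal complete subgraph (a vertex set of such a subgraph; an isolated vertex is a clique of size 1). The $(a,b)$-monochromatic clique transversal game ($(a,b)$-MCT game) on $G$ is played by Alice and Bob, who alternately take turns: in each of her turns Alice chooses $a$ unplayed vertices and colors them red, and in each of his turns Bob chooses $b$ unplayed vertices and colors them blue (if fewer unplayed vertices remain, the player colors all of them). Alice wins if the red vertices form a clique transversal, i.e. contain at least one vertex of each clique of $G$; Bob wins if all vertices of some clique of $G$ are blue. The game is Alice-start or Bob-start depending on who moves first. The threshold $a_1(G)$ (resp. $a_1'(G)$) is the smallest positive integer $a$ such that Alice has a winning strategy in the Alice-start (resp. Bob-start) $(a,1)$-MCT game on $G$. $n(G)$ is the number of vertices of $G$ and $\Delta(G)$ its maximum degree (with $\Delta = 0$ for the graph with no vertices, arising as $G-X$ with $X=V(G)$). For a non-negative integer $k$, $\alpha_k(G)$ is the $k$-independence number: the maximum cardinality of a set $S\subseteq V(G)$ such that the subgraph induced by $S$ has maximum degree at most $k$. $G-X$ is the graph obtained from $G$ by deleting the vertices of $X$. -}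

module Defs where

open import Data.Bool.Base using (true; false)
open import Data.Fin.Base using (Fin)
open import Data.Fin.Subset
open import Data.Fin.Subset.Properties using (_∈?_)
open import Data.List.Base as List using (List; []; _∷_; _++_; allFin; filter)
open import Data.List.Extrema.Nat using (max)
open import Data.List.Membership.Propositional using () renaming (_∈_ to _∈ˡ_)
open import Data.List.Membership.Propositional.Properties
  using (∈-++⁺ˡ; ∈-++⁺ʳ; ∈-map⁺)
open import Data.List.Relation.Unary.Any using (here)
open import Data.Nat.Base using (ℕ; zero; suc; _≤_; _⊓_)
open import Data.Nat.Properties using (_≤?_)
open import Data.Product.Base using (_×_; ∃-syntax)
open import Data.Vec.Base as Vec using ([]; _∷_)
open import Level using (0ℓ)
open import Relation.Binary.Core using (Rel)
open import Relation.Binary.Definitions using (Decidable; Irreflexive; Symmetric)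
open import Relation.Binary.PropositionalEquality using (_≡_; _≢_; refl)
open import Relation.Nullary using (¬_; does)

IsMinOf : {A : Set} → (A → ℕ) → ℕ → Set
IsMinOf f m = (∃[ x ] f x ≡ m) × (∀ x → m ≤ f x)

IsLeast : (ℕ → Set) → ℕ → Set
IsLeast P m = P m × (∀ k → P k → m ≤ k)

subsets : ∀ n → List (Subset n)
subsets zero    = [] ∷ []
subsets (suc n) = List.map (inside ∷_) (subsets n) ++ List.map (outside ∷_) (subsets n)

∈-subsets : ∀ {n} (S : Subset n) → S ∈ˡ subsets n
∈-subsets []          = here refl
∈-subsets (true ∷ S)  = ∈-++⁺ˡ (∈-map⁺ (inside ∷_) (∈-subsets S))
∈-subsets (false ∷ S) = ∈-++⁺ʳ (List.map (inside ∷_) (subsets _)) (∈-map⁺ (outside ∷_) (∈-subsets S))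

record Graph (n : ℕ) : Set₁ where
  infix 4 _~_ _~?_
  field
    _~_    : Rel (Fin n) 0ℓ
    _~?_   : Decidable _~_
    ~-sym  : Symmetric _~_
    ~-irr  : Irreflexive _≡_ _~_

data Player : Set where
  alice bob : Player

record Position (n : ℕ) : Set where
  constructor ⟨_,_⟩
  field
    red blue : Subset n

open Position

unplayed : ∀ {n} → Position n → Subset n
unplayed p = ∁ (red p ∪ blue p)

-- S is a legal choice for a player who colours c vertices per turn,
-- or all the unplayed ones if fewer than c remain.
LegalMove : ∀ {n} → ℕ → Position n → Subset n → Set
LegalMove c p S = S ⊆ unplayed p × ∣ S ∣ ≡ c ⊓ ∣ unplayed p ∣

module _ {n : ℕ} (G : Graph n) where
  open Graph G

  TriangleFree : Set
  TriangleFree = ∀ x y z → ¬ (x ~ y × y ~ z × x ~ z)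

  Isolated : Fin n → Set
  Isolated v = ∀ u → ¬ (v ~ u)

  neighbours : Fin n → Subset n
  neighbours v = Vec.tabulate (λ u → does (v ~? u))

  -- Maximum degree of the subgraph induced by S; it is 0 when S is empty.
  Δ-induced : Subset n → ℕ
  Δ-induced S = max 0 (List.map (λ v → ∣ neighbours v ∩ S ∣) (filter (_∈? S) (allFin n)))

  Δ : ℕ
  Δ = Δ-induced ⊤

  -- Δ(G − X): deleting X leaves the subgraph induced by the complement of X.
  Δ-minus : Subset n → ℕ
  Δ-minus X = Δ-induced (∁ X)

  -- The default value 0 is harmless: the empty set always qualifies.
  α : ℕ → ℕ
  α k = max 0 (List.map ∣_∣ (filter (λ S → Δ-induced S ≤? k) (subsets n)))

  Complete : Subset n → Set
  Complete S = ∀ {u v} → u ∈ S → v ∈ S → u ≢ v → u ~ v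

  Clique : Subset n → Set
  Clique S = Complete S × (∀ T → Complete T → S ⊆ T → T ⊆ S)

  CliqueTransversal : Subset n → Set
  CliqueTransversal R = ∀ Q → Clique Q → Nonempty (R ∩ Q)

  AliceHasWon BobHasWon : Position n → Set
  AliceHasWon p = CliqueTransversal (red p)
  BobHasWon   p = ∃[ Q ] Clique Q × Q ⊆ blue p

  -- Winning strategies for Alice in the (a,b)-MCT game from a given position with
  -- a given player to move, as well-founded strategy trees: a node picks one move on
  -- Alice's turns and answers all of Bob's moves on his turns, play stops as soon as
  -- someone has won, and every branch ends in a win for Alice.  On a full board the
  -- only legal move is the empty set, which changes nothing; being inductive, a tree
  -- cannot postpone the outcome forever by such moves.
  data AliceStrategy (a b : ℕ) : Player → Position n → Set where
    won       : ∀ {w p} → AliceHasWon p → AliceStrategy a b w p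
    aliceMove : ∀ {p} → ¬ BobHasWon p →
                ∀ S → LegalMove a p S →
                AliceStrategy a b bob ⟨ red p ∪ S , blue p ⟩ →
                AliceStrategy a b alice p
    bobMove   : ∀ {p} → ¬ BobHasWon p →
                (∀ S → LegalMove b p S → AliceStrategy a b alice ⟨ red p , blue p ∪ S ⟩) →
                AliceStrategy a b bob p

  AliceWinsMCT : Player → ℕ → ℕ → Set
  AliceWinsMCT first a b = AliceStrategy a b first ⟨ ⊥ , ⊥ ⟩

  -- "m is a₁(G)" and "m is a₁′(G)"; the existence of such an m is part of any
  -- statement asserting these.
  Is-a₁ Is-a₁′ : ℕ → Set
  Is-a₁  = IsLeast (λ a → 1 ≤ a × AliceWinsMCT alice a 1)
  Is-a₁′ = IsLeast (λ a → 1 ≤ a × AliceWinsMCT bob   a 1)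

{-# OPTIONS --safe #-}
-- Without triangles and isolated vertices the cliques are exactly the edges, so Alice has won once
-- every edge has a red endpoint and Bob once some edge is blue.  Suppose Bob is to move and only
-- red vertices R are coloured.  If every vertex of G − R has at most a neighbours in G − R, Alice
-- answers each blue vertex by colouring all its unplayed neighbours.  Otherwise Bob colours a vertex
-- with more than a such neighbours, and then one of those that Alice has left.  Hence Alice wins
-- exactly when Δ(G − R) ≤ a: take R empty in the Bob-start game, and R her first move in the
-- Alice-start game.  The minimum over k is the minimum over X with k = Δ(G − X).
module Submission where

open import Data.Bool.Base using (true; false)
open import Data.Fin.Base using (Fin; zero)
open import Data.Fin.Properties using (any?; _≟_)
open import Data.Fin.Subset
open import Data.Fin.Subset.Properties
open import Data.List.Base using (filter; allFin)
open import Data.List.Extrema.Nat using (argmin; argmax-all; f[argmin]≤f[xs]; max≤v⁺; xs≤max)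
open import Data.List.Membership.Propositional.Properties
  using (∈-map⁺; ∈-filter⁺; ∈-allFin)
import Data.List.Relation.Unary.All as All
open import Data.List.Relation.Unary.All.Properties using (map⁺; all-filter)
open import Data.Nat.Base using (ℕ; zero; suc; NonZero; _⊔_; _⊓_; _∸_; _≤_; _<_; z≤n; s≤s)
open import Data.Nat.Induction using (Acc; acc; <-wellFounded)
open import Data.Nat.Properties hiding (_≟_)
open import Data.Product.Base using (_×_; _,_; proj₁; proj₂; ∃-syntax)
open import Data.Sum.Base using (inj₁; inj₂; [_,_]′)
open import Data.Vec.Base using ([]; _∷_; here)
open import Data.Vec.Properties using (lookup∘tabulate; []=⇒lookup; lookup⇒[]=)
open import Function.Base using (_∘_; id; flip)
open import Relation.Binary.PropositionalEquality
open import Relation.Nullary using (¬_; yes; no; contradiction; does)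
open import Relation.Nullary.Decidable using (dec-true; _×-dec_)
open import Defs

open Position

private variable
  n : ℕ

-- Sizes of finite subsets

1≤∣p∣ : ∀ {x} {p : Subset n} → x ∈ p → 1 ≤ ∣ p ∣
1≤∣p∣ {x = x} {p} x∈p = subst (_≤ ∣ p ∣) (∣⁅x⁆∣≡1 x)
  (p⊆q⇒∣p∣≤∣q∣ λ y∈⁅x⁆ → subst (_∈ p) (sym (x∈⁅y⁆⇒x≡y x y∈⁅x⁆)) x∈p)

∣p∣≡0⇒p≡⊥ : (p : Subset n) → ∣ p ∣ ≡ 0 → p ≡ ⊥
∣p∣≡0⇒p≡⊥ p ∣p∣≡0 = Empty-unique λ (_ , x∈p) → contradiction (1≤∣p∣ x∈p) (≤⇒≯ (≤-reflexive ∣p∣≡0))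

∣p∣≡1⇒p≡⁅x⁆ : (p : Subset n) → ∣ p ∣ ≡ 1 → ∃[ x ] p ≡ ⁅ x ⁆
∣p∣≡1⇒p≡⁅x⁆ (true  ∷ p) eq = zero , cong (inside ∷_) (∣p∣≡0⇒p≡⊥ p (suc-injective eq))
∣p∣≡1⇒p≡⁅x⁆ (false ∷ p) eq with ∣p∣≡1⇒p≡⁅x⁆ p eq
... | x , refl = Fin.suc x , refl

∣p∣<∣q∣⇒∃∈q∖p : (p q : Subset n) → ∣ p ∣ < ∣ q ∣ → ∃[ x ] x ∈ q × x ∉ p
∣p∣<∣q∣⇒∃∈q∖p p q ∣p∣<∣q∣ with nonempty? (q ∩ ∁ p)
... | yes (x , x∈q∩∁p) = let x∈q , x∈∁p = x∈p∩q⁻ q (∁ p) x∈q∩∁p in x , x∈q , x∈∁p⇒x∉p x∈∁p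
... | no empty = contradiction (p⊆q⇒∣p∣≤∣q∣ q⊆p) (<⇒≱ ∣p∣<∣q∣)
  where
  q⊆p : q ⊆ p
  q⊆p {x} x∈q with x ∈? p
  ... | yes x∈p = x∈p
  ... | no  x∉p = contradiction (x , x∈p∩q⁺ (x∈q , x∉p⇒x∈∁p x∉p)) empty

∩-monoʳ-∣∣ : ∀ (p : Subset n) {q r} → q ⊆ r → ∣ p ∩ q ∣ ≤ ∣ p ∩ r ∣
∩-monoʳ-∣∣ p {q} {r} q⊆r = p⊆q⇒∣p∣≤∣q∣ {p = p ∩ q} {p ∩ r} λ x∈p∩q →
  let x∈p , x∈q = x∈p∩q⁻ p q x∈p∩q in x∈p∩q⁺ (x∈p , q⊆r x∈q)

-- A legal move has a prescribed size, so the vertices that Alice wants to colour have to be padded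
-- with other unplayed ones.
extend-to-size : ∀ c (p q : Subset n) → p ⊆ q → ∣ p ∣ ≤ c → c ≤ ∣ q ∣ →
                 ∃[ r ] p ⊆ r × r ⊆ q × ∣ r ∣ ≡ c
extend-to-size zero p q p⊆q ∣p∣≤0 _ = p , id , p⊆q , n≤0⇒n≡0 ∣p∣≤0
extend-to-size (suc c) [] [] _ _ ()
extend-to-size (suc c) (true ∷ p) (false ∷ q) p⊆q _ _ with () ← p⊆q here
extend-to-size (suc c) (true ∷ p) (true ∷ q) p⊆q (s≤s ∣p∣≤c) (s≤s c≤∣q∣)
  with r , p⊆r , r⊆q , ∣r∣≡c ← extend-to-size c p q (drop-∷-⊆ p⊆q) ∣p∣≤c c≤∣q∣
  = inside ∷ r , in⊆in p⊆r , in⊆in r⊆q , cong suc ∣r∣≡c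
extend-to-size (suc c) (false ∷ p) (false ∷ q) p⊆q ∣p∣≤c c≤∣q∣
  with r , p⊆r , r⊆q , ∣r∣≡c ← extend-to-size (suc c) p q (drop-∷-⊆ p⊆q) ∣p∣≤c c≤∣q∣
  = outside ∷ r , out⊆ p⊆r , out⊆ r⊆q , ∣r∣≡c
extend-to-size (suc c) (false ∷ p) (true ∷ q) p⊆q ∣p∣≤1+c (s≤s c≤∣q∣)
  with m≤n⇒m<n∨m≡n ∣p∣≤1+c
... | inj₂ ∣p∣≡1+c = outside ∷ p , id , p⊆q , ∣p∣≡1+c
... | inj₁ (s≤s ∣p∣≤c)
  with r , p⊆r , r⊆q , ∣r∣≡c ← extend-to-size c p q (drop-∷-⊆ p⊆q) ∣p∣≤c c≤∣q∣
  = inside ∷ r , out⊆ p⊆r , in⊆in r⊆q , cong suc ∣r∣≡c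

-- Positions and legal moves

∈-unplayed⁺ : ∀ (p : Position n) {x} → x ∉ red p → x ∉ blue p → x ∈ unplayed p
∈-unplayed⁺ p x∉r x∉b = x∉p⇒x∈∁p ([ x∉r , x∉b ]′ ∘ x∈p∪q⁻ (red p) (blue p))

∈-unplayed⇒∉red : ∀ (p : Position n) {x} → x ∈ unplayed p → x ∉ red p
∈-unplayed⇒∉red p x∈u x∈r = x∈∁p⇒x∉p x∈u (x∈p∪q⁺ (inj₁ x∈r))

∈-unplayed⇒∉blue : ∀ (p : Position n) {x} → x ∈ unplayed p → x ∉ blue p
∈-unplayed⇒∉blue p x∈u x∈b = x∈∁p⇒x∉p x∈u (x∈p∪q⁺ (inj₂ x∈b))

∉-∪ : ∀ {p q : Subset n} {x} → x ∉ p → x ∉ q → x ∉ p ∪ q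
∉-∪ {p = p} {q} x∉p x∉q = [ x∉p , x∉q ]′ ∘ x∈p∪q⁻ p q

legal-singleton : ∀ (p : Position n) {x} → x ∈ unplayed p → LegalMove 1 p ⁅ x ⁆
legal-singleton p {x} x∈u =
  (λ y∈⁅x⁆ → subst (_∈ unplayed p) (sym (x∈⁅y⁆⇒x≡y x y∈⁅x⁆)) x∈u) ,
  trans (∣⁅x⁆∣≡1 x) (sym (m≤n⇒m⊓n≡m (1≤∣p∣ x∈u)))

legal-extension : ∀ a (p : Position n) T → T ⊆ unplayed p → ∣ T ∣ ≤ a →
                  ∃[ S ] T ⊆ S × LegalMove a p S
legal-extension a p T T⊆u ∣T∣≤a
  with S , T⊆S , S⊆u , ∣S∣≡c ← extend-to-size (a ⊓ ∣ unplayed p ∣) T (unplayed p) T⊆u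
         (⊓-glb ∣T∣≤a (p⊆q⇒∣p∣≤∣q∣ T⊆u)) (m⊓n≤n a _)
  = S , T⊆S , S⊆u , ∣S∣≡c

legal-size : ∀ {a S} (p : Position n) → LegalMove a p S → ∣ S ∣ ≤ a
legal-size {a = a} p (_ , ∣S∣≡c) = ≤-trans (≤-reflexive ∣S∣≡c) (m⊓n≤m a _)

minOverSubsets : (f : Subset n → ℕ) → ∃[ m ] IsMinOf f m
-- `⊤` is only the starting candidate of `argmin`; any subset would do.
minOverSubsets {n} f = _ , (argmin f ⊤ (subsets n) , refl) ,
  λ X → All.lookup (f[argmin]≤f[xs] {f = f} ⊤ (subsets n)) (∈-subsets X)

module _ {n : ℕ} (G : Graph n) where
  open Graph G

  -- Induced degrees and the numbers `α G k`

  ∈-neighbours⁺ : ∀ {u v} → v ~ u → u ∈ neighbours G v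
  ∈-neighbours⁺ {u} {v} v~u = lookup⇒[]= u _
    (trans (lookup∘tabulate _ u) (dec-true (v ~? u) v~u))

  ∈-neighbours⁻ : ∀ {u v} → u ∈ neighbours G v → v ~ u
  ∈-neighbours⁻ {u} {v} u∈N with v ~? u | trans (sym (lookup∘tabulate (λ u → does (v ~? u)) u)) ([]=⇒lookup u∈N)
  ... | yes v~u | _ = v~u

  degree-≤Δ-induced : ∀ {S v} → v ∈ S → ∣ neighbours G v ∩ S ∣ ≤ Δ-induced G S
  degree-≤Δ-induced {S} v∈S = All.lookup (xs≤max 0 _)
    (∈-map⁺ _ (∈-filter⁺ (_∈? S) (∈-allFin _) v∈S))

  Δ-induced-≤ : ∀ {S a} → (∀ v → v ∈ S → ∣ neighbours G v ∩ S ∣ ≤ a) → Δ-induced G S ≤ a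
  Δ-induced-≤ {S} bound = max≤v⁺ z≤n
    (map⁺ (All.map (bound _) (all-filter (_∈? S) (allFin n))))

  Δ-induced-mono : ∀ {S T} → S ⊆ T → Δ-induced G S ≤ Δ-induced G T
  Δ-induced-mono S⊆T = Δ-induced-≤ λ v v∈S → ≤-trans
    (∩-monoʳ-∣∣ (neighbours G v) S⊆T)
    (degree-≤Δ-induced (S⊆T v∈S))

  edge⇒1≤Δ-induced : ∀ {S u v} → u ~ v → u ∈ S → v ∈ S → 1 ≤ Δ-induced G S
  edge⇒1≤Δ-induced u~v u∈S v∈S =
    ≤-trans (1≤∣p∣ (x∈p∩q⁺ (∈-neighbours⁺ u~v , v∈S))) (degree-≤Δ-induced u∈S)

  α-attained : ∀ k → ∃[ S ] Δ-induced G S ≤ k × ∣ S ∣ ≡ α G k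
  α-attained k = argmax-all id {P = λ m → ∃[ S ] Δ-induced G S ≤ k × ∣ S ∣ ≡ m}
    -- The default value 0 of `max` is realised by the empty set.
    (⊥ , Δ-induced-≤ (λ _ v∈⊥ → contradiction v∈⊥ ∉⊥) , ∣⊥∣≡0 n)
    (map⁺ (All.map (λ {S} Δ≤k → S , Δ≤k , refl)
      (all-filter (λ S → Δ-induced G S ≤? k) (subsets n))))

  ∣S∣≤α : ∀ {k S} → Δ-induced G S ≤ k → ∣ S ∣ ≤ α G k
  ∣S∣≤α {k} {S} Δ≤k = All.lookup (xs≤max 0 _)
    (∈-map⁺ ∣_∣ (∈-filter⁺ (λ S → Δ-induced G S ≤? k) (∈-subsets S) Δ≤k))

  -- Given `k`, the complement of a largest `S` of induced degree at most `k` is a set `X` whose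
  -- value is no larger. Conversely, for a minimising `X` take `k = Δ-minus G X`: then `∁ X` is a
  -- candidate in `α G k`, so `n ∸ α G k` is at most `∣ X ∣`.
  minOverSubsets⇒minOverDegrees : ∀ {m} → IsMinOf (λ X → Δ-minus G X ⊔ ∣ X ∣) m →
                                  IsMinOf (λ k → k ⊔ (n ∸ α G k)) m
  minOverSubsets⇒minOverDegrees {m} ((X , fX≡m) , m≤f) =
    (Δ-minus G X , ≤-antisym upper (lower _)) , lower
    where
    lower : ∀ k → m ≤ k ⊔ (n ∸ α G k)
    lower k with S , Δ≤k , ∣S∣≡αk ← α-attained k = ≤-trans (m≤f (∁ S)) (⊔-mono-≤
      (≤-trans (Δ-induced-mono (x∉∁p⇒x∈p ∘ x∈∁p⇒x∉p)) Δ≤k)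
      (≤-reflexive (trans (∣∁p∣≡n∸∣p∣ S) (cong (n ∸_) ∣S∣≡αk))))

    n∸α≤∣X∣ : n ∸ α G (Δ-minus G X) ≤ ∣ X ∣
    n∸α≤∣X∣ = begin
      n ∸ α G (Δ-minus G X)  ≤⟨ ∸-monoʳ-≤ n (∣S∣≤α ≤-refl) ⟩
      n ∸ ∣ ∁ X ∣            ≡⟨ cong (n ∸_) (∣∁p∣≡n∸∣p∣ X) ⟩
      n ∸ (n ∸ ∣ X ∣)        ≡⟨ m∸[m∸n]≡n (∣p∣≤n X) ⟩
      ∣ X ∣                  ∎
      where open ≤-Reasoning

    upper : Δ-minus G X ⊔ (n ∸ α G (Δ-minus G X)) ≤ m
    upper = ≤-trans (⊔-mono-≤ (≤-refl {Δ-minus G X}) n∸α≤∣X∣) (≤-reflexive fX≡m)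

  -- Complete sets and cliques

  singleton-complete : ∀ x → Complete G ⁅ x ⁆
  singleton-complete x u∈ v∈ u≢v =
    contradiction (trans (x∈⁅y⁆⇒x≡y x u∈) (sym (x∈⁅y⁆⇒x≡y x v∈))) u≢v

  pair-cases : ∀ {u v x} {P : Fin n → Set} → P u → P v → x ∈ ⁅ u ⁆ ∪ ⁅ v ⁆ → P x
  pair-cases {u} {v} {P = P} Pu Pv x∈ with x∈p∪q⁻ ⁅ u ⁆ ⁅ v ⁆ x∈
  ... | inj₁ x∈⁅u⁆ = subst P (sym (x∈⁅y⁆⇒x≡y u x∈⁅u⁆)) Pu
  ... | inj₂ x∈⁅v⁆ = subst P (sym (x∈⁅y⁆⇒x≡y v x∈⁅v⁆)) Pv

  pair-complete : ∀ {u v} → u ~ v → Complete G (⁅ u ⁆ ∪ ⁅ v ⁆)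
  pair-complete {u} {v} u~v x∈ y∈ = pair-cases {P = λ x → x ≢ _ → x ~ _}
    (pair-cases {P = λ y → u ≢ y → u ~ y} (contradiction refl) (λ _ → u~v) y∈)
    (pair-cases {P = λ y → v ≢ y → v ~ y} (λ _ → ~-sym u~v) (contradiction refl) y∈)
    x∈

  -- A third vertex of a complete superset would form a triangle with the edge.
  edge-clique : TriangleFree G → ∀ {u v} → u ~ v → Clique G (⁅ u ⁆ ∪ ⁅ v ⁆)
  edge-clique triangleFree {u} {v} u~v = pair-complete u~v , maximal
    where
    maximal : ∀ T → Complete G T → ⁅ u ⁆ ∪ ⁅ v ⁆ ⊆ T → T ⊆ ⁅ u ⁆ ∪ ⁅ v ⁆
    maximal T complete uv⊆T {x} x∈T with x ≟ u | x ≟ v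
    ... | yes refl | _        = x∈p∪q⁺ (inj₁ (x∈⁅x⁆ u))
    ... | no _     | yes refl = x∈p∪q⁺ (inj₂ (x∈⁅x⁆ v))
    ... | no x≢u   | no x≢v   = contradiction
      ( complete x∈T (uv⊆T (x∈p∪q⁺ (inj₁ (x∈⁅x⁆ u)))) x≢u
      , u~v
      , complete x∈T (uv⊆T (x∈p∪q⁺ (inj₂ (x∈⁅x⁆ v)))) x≢v )
      (triangleFree x u v)

  -- The invariant of Alice's strategy, with Bob to move.
  record Safe (a : ℕ) (p : Position n) : Set where
    field
      disjoint : ∀ {x} → x ∈ red p → x ∉ blue p
      guarded  : ∀ {u v} → u ∈ blue p → u ~ v → v ∈ red p
      bounded  : ∀ {v} → v ∉ red p → ∣ neighbours G v ∩ ∁ (red p) ∣ ≤ a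

  module Game (v₀ : Fin n) (triangleFree : TriangleFree G) (noIsolated : ∀ v → ¬ Isolated G v) where

    -- Winning positions in terms of edges

    hasNeighbour : ∀ v → ∃[ u ] v ~ u
    hasNeighbour v with any? (v ~?_)
    ... | yes u = u
    ... | no ∄u = contradiction (λ u v~u → ∄u (u , v~u)) (noIsolated v)

    clique-edge : ∀ {Q} → Clique G Q → ∃[ u ] ∃[ v ] u ∈ Q × v ∈ Q × u ~ v
    clique-edge {Q} (complete , maximal) with nonempty? Q
    -- The empty set is not maximal, since `⁅ v₀ ⁆` is complete.
    ... | no empty = contradiction
      (v₀ , maximal ⁅ v₀ ⁆ (singleton-complete v₀) (λ x∈Q → contradiction (_ , x∈Q) empty) (x∈⁅x⁆ v₀))
      empty
    ... | yes (u , u∈Q) with any? (λ v → (v ∈? Q) ×-dec (u ~? v)) | hasNeighbour u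
    ... | yes (v , v∈Q , u~v) | _ = u , v , u∈Q , v∈Q , u~v
    -- Completeness now leaves only `u` in `Q`, so the edge from `u` to `w` extends `Q`, and
    -- maximality puts `w` into `Q` after all.
    ... | no ∄v | w , u~w = contradiction (w , maximal _ (pair-complete u~w) Q⊆uw (x∈p∪q⁺ (inj₂ (x∈⁅x⁆ w))) , u~w) ∄v
      where
      Q⊆uw : Q ⊆ ⁅ u ⁆ ∪ ⁅ w ⁆
      Q⊆uw {x} x∈Q with u ≟ x
      ... | yes refl = x∈p∪q⁺ (inj₁ (x∈⁅x⁆ u))
      ... | no  u≢x  = contradiction (x , x∈Q , complete u∈Q x∈Q u≢x) ∄v

    uncovered-edge : ∀ {u v R} → u ~ v → u ∉ R → v ∉ R → ¬ CliqueTransversal G R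
    uncovered-edge {R = R} u~v u∉R v∉R transversal
      with x , x∈ ← transversal _ (edge-clique triangleFree u~v)
      with x∈R , x∈uv ← x∈p∩q⁻ R _ x∈
      = pair-cases {P = _∉ R} u∉R v∉R x∈uv x∈R

    edgeCover⇒transversal : ∀ {R} → (∀ {u v} → u ~ v → u ∉ R → v ∈ R) → CliqueTransversal G R
    edgeCover⇒transversal {R} cover Q clique
      with u , v , u∈Q , v∈Q , u~v ← clique-edge clique
      with u ∈? R
    ... | yes u∈R = u , x∈p∩q⁺ (u∈R , u∈Q)
    ... | no  u∉R = v , x∈p∩q⁺ (cover u~v u∉R , v∈Q)

    independent⇒¬BobHasWon : ∀ p → (∀ {u v} → u ∈ blue p → v ∈ blue p → ¬ (u ~ v)) → ¬ BobHasWon G p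
    independent⇒¬BobHasWon p independent (Q , clique , Q⊆b)
      with u , v , u∈Q , v∈Q , u~v ← clique-edge clique
      = independent (Q⊆b u∈Q) (Q⊆b v∈Q) u~v

    blue-edge⇒BobHasWon : ∀ p {u v} → u ~ v → u ∈ blue p → v ∈ blue p → BobHasWon G p
    blue-edge⇒BobHasWon p u~v u∈b v∈b =
      _ , edge-clique triangleFree u~v , pair-cases {P = _∈ blue p} u∈b v∈b

    -- Alice's strategy

    safe⇒¬BobHasWon : ∀ {a p} → Safe a p → ¬ BobHasWon G p
    safe⇒¬BobHasWon {p = p} safe = independent⇒¬BobHasWon p λ u∈b v∈b u~v →
      disjoint (guarded u∈b u~v) v∈b
      where open Safe safe

    -- One round from a safe position: Bob colours `w`, and Alice any unplayed set `S` that contains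
    -- `threatened`.
    module Reply {a p w} (safe : Safe a p) (w∈u : w ∈ unplayed p) where
      open Safe safe

      afterBob : Position n
      afterBob = ⟨ red p , blue p ∪ ⁅ w ⁆ ⟩

      threatened : Subset n
      threatened = neighbours G w ∩ unplayed afterBob

      w∉red : w ∉ red p
      w∉red = ∈-unplayed⇒∉red p w∈u

      blue-cases : ∀ {x} {P : Fin n → Set} → (x ∈ blue p → P x) → P w → x ∈ blue p ∪ ⁅ w ⁆ → P x
      blue-cases {P = P} f Pw x∈ with x∈p∪q⁻ (blue p) ⁅ w ⁆ x∈
      ... | inj₁ x∈b   = f x∈b
      ... | inj₂ x∈⁅w⁆ = subst P (sym (x∈⁅y⁆⇒x≡y w x∈⁅w⁆)) Pw

      -- Vertices that were blue before have only red neighbours, and `w` is not red.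
      ¬BobHasWon-afterBob : ¬ BobHasWon G afterBob
      ¬BobHasWon-afterBob = independent⇒¬BobHasWon afterBob λ {u} {v} u∈ v∈ →
        blue-cases {P = λ u → ¬ (u ~ v)}
          (λ u∈b → blue-cases {P = λ v → ¬ (u ~ v)}
            (λ v∈b u~v → disjoint (guarded u∈b u~v) v∈b)
            (λ u~w → w∉red (guarded u∈b u~w)) v∈)
          (blue-cases {P = λ v → ¬ (w ~ v)}
            (λ v∈b w~v → w∉red (guarded v∈b (~-sym w~v)))
            (~-irr refl) v∈)
          u∈

      ∣threatened∣≤a : ∣ threatened ∣ ≤ a
      ∣threatened∣≤a = ≤-trans
        (∩-monoʳ-∣∣ (neighbours G w) (x∉p⇒x∈∁p ∘ ∈-unplayed⇒∉red afterBob))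
        (bounded w∉red)

      module _ {S} (threatened⊆S : threatened ⊆ S) (S⊆u : S ⊆ unplayed afterBob) where

        afterAlice : Position n
        afterAlice = ⟨ red p ∪ S , blue p ∪ ⁅ w ⁆ ⟩

        -- The degree bound survives because the red set only grows. A neighbour of `w` is red
        -- already or lies in `threatened`: were it blue, `guarded` would make `w` red.
        safe-afterAlice : Safe a afterAlice
        safe-afterAlice = record
          { disjoint = λ x∈r x∈b → [ (λ x∈r → blue-cases {P = _∉ red p} (flip disjoint) w∉red x∈b x∈r)
                                   , (λ x∈S → ∈-unplayed⇒∉blue afterBob (S⊆u x∈S) x∈b) ]′
                                   (x∈p∪q⁻ (red p) S x∈r)
          ; guarded  = λ {u} {v} u∈b → blue-cases {P = λ u → u ~ v → v ∈ red p ∪ S}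
                         (λ u∈b u~v → x∈p∪q⁺ (inj₁ (guarded u∈b u~v))) w-guarded u∈b
          ; bounded  = λ {v} v∉r → ≤-trans
              (∩-monoʳ-∣∣ (neighbours G v) (p⊆q⇒∁p⊇∁q (p⊆p∪q S)))
              (bounded (v∉r ∘ p⊆p∪q S))
          }
          where
          w-guarded : ∀ {v} → w ~ v → v ∈ red p ∪ S
          w-guarded {v} w~v with v ∈? red p
          ... | yes v∈r = x∈p∪q⁺ (inj₁ v∈r)
          ... | no  v∉r = x∈p∪q⁺ (inj₂ (threatened⊆S (x∈p∩q⁺ (∈-neighbours⁺ w~v ,
            ∈-unplayed⁺ afterBob v∉r λ v∈b → blue-cases {P = λ v → ¬ (w ~ v)}
              (λ v∈b w~v → w∉red (guarded v∈b (~-sym w~v))) (~-irr refl) v∈b w~v))))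

        -- The vertex `w` has been used up; this makes the recursion in `safe⇒strategy`
        -- well-founded.
        fewer-unplayed : ∣ unplayed afterAlice ∣ < ∣ unplayed p ∣
        fewer-unplayed = p⊂q⇒∣p∣<∣q∣ (shrink , w , w∈u ,
          λ w∈u′ → ∈-unplayed⇒∉blue afterAlice w∈u′ (x∈p∪q⁺ (inj₂ (x∈⁅x⁆ w))))
          where
          shrink : unplayed afterAlice ⊆ unplayed p
          shrink x∈ = ∈-unplayed⁺ p (∈-unplayed⇒∉red afterAlice x∈ ∘ p⊆p∪q S)
                                    (∈-unplayed⇒∉blue afterAlice x∈ ∘ p⊆p∪q ⁅ w ⁆)

    safe⇒strategy : ∀ {a} p → Acc _<_ ∣ unplayed p ∣ → Safe a p → AliceStrategy G a 1 bob p
    safe⇒strategy {a} p (acc rec) safe with nonempty? (unplayed p)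
    -- On a full board every vertex that is not red is blue, so `guarded` makes its neighbours red.
    ... | no full = won (edgeCover⇒transversal cover)
      where
      open Safe safe
      cover : ∀ {u v} → u ~ v → u ∉ red p → v ∈ red p
      cover {u} u~v u∉r with u ∈? blue p
      ... | yes u∈b = guarded u∈b u~v
      ... | no  u∉b = contradiction (u , ∈-unplayed⁺ p u∉r u∉b) full
    ... | yes (_ , y∈u) = bobMove (safe⇒¬BobHasWon safe) answer
      where
      answer : ∀ S → LegalMove 1 p S → AliceStrategy G a 1 alice ⟨ red p , blue p ∪ S ⟩
      answer S (S⊆u , ∣S∣≡c) with ∣p∣≡1⇒p≡⁅x⁆ S (trans ∣S∣≡c (m≤n⇒m⊓n≡m (1≤∣p∣ y∈u)))
      ... | w , refl = reply
        where
        open Reply safe (S⊆u (x∈⁅x⁆ w))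
        reply : AliceStrategy G a 1 alice afterBob
        reply with T , t⊆T , legal ← legal-extension a afterBob threatened (p∩q⊆q _ _) ∣threatened∣≤a
          = aliceMove ¬BobHasWon-afterBob T legal
              (safe⇒strategy _ (rec (fewer-unplayed t⊆T (proj₁ legal))) (safe-afterAlice t⊆T (proj₁ legal)))

    Δ-minus≤⇒strategy : ∀ {a R} → Δ-minus G R ≤ a → AliceStrategy G a 1 bob ⟨ R , ⊥ ⟩
    Δ-minus≤⇒strategy Δ≤a = safe⇒strategy _ (<-wellFounded _) record
      { disjoint = λ _ → ∉⊥
      ; guarded  = λ u∈⊥ → contradiction u∈⊥ ∉⊥
      ; bounded  = λ v∉R → ≤-trans (degree-≤Δ-induced (x∉p⇒x∈∁p v∉R)) Δ≤a
      }

    -- Bob's strategy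

    strategy⇒Δ-minus≤ : ∀ {a R} → AliceStrategy G a 1 bob ⟨ R , ⊥ ⟩ → Δ-minus G R ≤ a
    strategy⇒Δ-minus≤ {a} {R} strategy = Δ-induced-≤ λ v v∈∁R → ≮⇒≥ (refute v (x∈∁p⇒x∉p v∈∁R) strategy)
      where
      freeNeighbour : ∀ v (S : Subset n) → ∣ S ∣ < ∣ neighbours G v ∩ ∁ R ∣ → ∃[ u ] v ~ u × u ∉ R × u ∉ S
      freeNeighbour v S ∣S∣< with u , u∈ , u∉S ← ∣p∣<∣q∣⇒∃∈q∖p S _ ∣S∣<
        with u∈N , u∈∁R ← x∈p∩q⁻ _ _ u∈
        = u , ∈-neighbours⁻ u∈N , x∈∁p⇒x∉p u∈∁R , u∉S

      module _ v (v∉R : v ∉ R) where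

        refute-alice : AliceStrategy G a 1 alice ⟨ R , ⊥ ∪ ⁅ v ⁆ ⟩ → ¬ (a < ∣ neighbours G v ∩ ∁ R ∣)
        refute-bob : ∀ {S u} → v ~ u → v ∉ R ∪ S → u ∉ R ∪ S →
                     ¬ AliceStrategy G a 1 bob ⟨ R ∪ S , ⊥ ∪ ⁅ v ⁆ ⟩

        -- The degree of `v` exceeds `a`, so `v` has a neighbour outside `R`; `⊥` stands in for the
        -- move that Alice does not make.
        refute-alice (won transversal) a<d
          with u , v~u , u∉R , _ ← freeNeighbour v ⊥ (≤-<-trans (≤-trans (≤-reflexive (∣⊥∣≡0 n)) z≤n) a<d)
          = uncovered-edge v~u v∉R u∉R transversal
        refute-alice (aliceMove _ S legal next) a<d
          with u , v~u , u∉R , u∉S ← freeNeighbour v S (≤-<-trans (legal-size ⟨ R , ⊥ ∪ ⁅ v ⁆ ⟩ legal) a<d)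
          = refute-bob v~u (∉-∪ v∉R v∉S) (∉-∪ u∉R u∉S) next
          where
          v∉S : v ∉ S
          v∉S v∈S = ∈-unplayed⇒∉blue ⟨ R , ⊥ ∪ ⁅ v ⁆ ⟩ (proj₁ legal v∈S) (x∈p∪q⁺ (inj₂ (x∈⁅x⁆ v)))

        refute-bob v~u v∉ u∉ (won transversal) = uncovered-edge v~u v∉ u∉ transversal
        refute-bob {S} {u} v~u v∉ u∉ (bobMove _ next)
          with next ⁅ u ⁆ (legal-singleton ⟨ R ∪ S , ⊥ ∪ ⁅ v ⁆ ⟩ (∈-unplayed⁺ ⟨ R ∪ S , ⊥ ∪ ⁅ v ⁆ ⟩ u∉
                 (∉-∪ ∉⊥ λ u∈⁅v⁆ → ~-irr (sym (x∈⁅y⁆⇒x≡y v u∈⁅v⁆)) v~u)))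
        -- Alice's tree could go on in two ways: by a red transversal, which misses the edge between
        -- `v` and `u`, or by a move, which is ruled out because that edge is now blue.
        ... | won transversal = uncovered-edge v~u v∉ u∉ transversal
        ... | aliceMove ¬bob _ _ _ = ¬bob (blue-edge⇒BobHasWon ⟨ R ∪ S , (⊥ ∪ ⁅ v ⁆) ∪ ⁅ u ⁆ ⟩ v~u
          (p⊆p∪q ⁅ u ⁆ (x∈p∪q⁺ (inj₂ (x∈⁅x⁆ v)))) (x∈p∪q⁺ (inj₂ (x∈⁅x⁆ u))))

        refute : AliceStrategy G a 1 bob ⟨ R , ⊥ ⟩ → ¬ (a < ∣ neighbours G v ∩ ∁ R ∣)
        -- A win depends on the red set alone, and Bob's move would leave it equal to `R`.
        refute (won transversal) a<d = refute-alice (won transversal) a<d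
        refute (bobMove _ next)  a<d =
          refute-alice (next ⁅ v ⁆ (legal-singleton _ (∈-unplayed⁺ ⟨ R , ⊥ ⟩ v∉R ∉⊥))) a<d

    -- The thresholds

    Δ-minus⊔size≤⇒AliceWins : ∀ {a} X → Δ-minus G X ⊔ ∣ X ∣ ≤ a → AliceWinsMCT G alice a 1
    Δ-minus⊔size≤⇒AliceWins {a} X fX≤a
      with S , X⊆S , legal ← legal-extension a ⟨ ⊥ , ⊥ ⟩ X (λ _ → ∈-unplayed⁺ ⟨ ⊥ , ⊥ ⟩ ∉⊥ ∉⊥)
             (m⊔n≤o⇒n≤o (Δ-minus G X) ∣ X ∣ fX≤a)
      = aliceMove (independent⇒¬BobHasWon ⟨ ⊥ , ⊥ ⟩ λ u∈⊥ → contradiction u∈⊥ ∉⊥) S legal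
          -- Padding `X` to the legal move `S` deletes further vertices, which cannot raise the
          -- maximum degree.
          (Δ-minus≤⇒strategy (≤-trans
            (Δ-induced-mono (p⊆q⇒∁p⊇∁q (q⊆p∪q ⊥ S ∘ X⊆S)))
            (m⊔n≤o⇒m≤o (Δ-minus G X) ∣ X ∣ fX≤a)))

    AliceWins⇒Δ-minus⊔size≤ : ∀ {a} → AliceWinsMCT G alice a 1 → ∃[ X ] Δ-minus G X ⊔ ∣ X ∣ ≤ a
    AliceWins⇒Δ-minus⊔size≤ (won transversal) =
      contradiction transversal (uncovered-edge (proj₂ (hasNeighbour v₀)) ∉⊥ ∉⊥)
    -- Her first move is the witness: Bob has coloured nothing yet, so `strategy⇒Δ-minus≤` applies
    -- to it.
    AliceWins⇒Δ-minus⊔size≤ {a} (aliceMove _ S legal next) = S ,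
      ⊔-lub (subst (λ R → Δ-minus G R ≤ a) (∪-identityˡ S) (strategy⇒Δ-minus≤ next))
            (legal-size ⟨ ⊥ , ⊥ ⟩ legal)

    -- The threshold has to be positive. An edge at `v₀` either meets `X` or survives its deletion.
    1≤Δ-minus⊔size : ∀ X → 1 ≤ Δ-minus G X ⊔ ∣ X ∣
    1≤Δ-minus⊔size X with u , v₀~u ← hasNeighbour v₀ with v₀ ∈? X | u ∈? X
    ... | yes v₀∈X | _       = ≤-trans (1≤∣p∣ v₀∈X) (m≤n⊔m _ _)
    ... | no _     | yes u∈X = ≤-trans (1≤∣p∣ u∈X) (m≤n⊔m _ _)
    ... | no v₀∉X  | no u∉X  =
      ≤-trans (edge⇒1≤Δ-induced v₀~u (x∉p⇒x∈∁p v₀∉X) (x∉p⇒x∈∁p u∉X)) (m≤m⊔n _ _)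

    minOverSubsets⇒a₁ : ∀ {m} → IsMinOf (λ X → Δ-minus G X ⊔ ∣ X ∣) m → Is-a₁ G m
    minOverSubsets⇒a₁ ((X , refl) , m≤f) =
      (1≤Δ-minus⊔size X , Δ-minus⊔size≤⇒AliceWins X ≤-refl) ,
      λ _ (_ , wins) → let Y , fY≤k = AliceWins⇒Δ-minus⊔size≤ wins in ≤-trans (m≤f Y) fY≤k

    Δ-is-a₁′ : Is-a₁′ G (Δ G)
    Δ-is-a₁′ =
      -- Both uses of monotonicity only exchange `∁ ⊥`, from the empty board, for the `⊤` in `Δ G`.
      (edge⇒1≤Δ-induced (proj₂ (hasNeighbour v₀)) ∈⊤ ∈⊤ , Δ-minus≤⇒strategy (Δ-induced-mono (λ _ → ∈⊤))) ,
      λ _ (_ , wins) → ≤-trans (Δ-induced-mono (λ _ → x∉p⇒x∈∁p ∉⊥)) (strategy⇒Δ-minus≤ wins)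

theorem2p1 : ∀ (n : ℕ) → .{{_ : NonZero n}} → (G : Graph n) → TriangleFree G → (∀ v → ¬ Isolated G v) →
    (∃[ m ] Is-a₁ G m × IsMinOf (λ k → k ⊔ (n ∸ α G k)) m × IsMinOf (λ X → Δ-minus G X ⊔ ∣ X ∣) m)
    × Is-a₁′ G (Δ G)
theorem2p1 (suc _) G triangleFree noIsolated =
  (m , minOverSubsets⇒a₁ isMin , minOverSubsets⇒minOverDegrees G isMin , isMin) , Δ-is-a₁′
  where
  open Game G zero triangleFree noIsolated
  m = proj₁ (minOverSubsets (λ X → Δ-minus G X ⊔ ∣ X ∣))
  isMin = proj₂ (minOverSubsets (λ X → Δ-minus G X ⊔ ∣ X ∣))
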